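{- There are exactly $2$ pairwise non-isomorphic $(K_4-e)$-designs of order $11$.
   Context: $K_4-e$ is the graph on four vertices $a,b,c,d$ with edges $ab,ac,ad,bc,bd$; it is denoted $[a,b,c-d]$. A $(K_4-e)$-design of order $v$ is a pair $(X,\mathcal B)$ where $X$ is a set of $v$ vertices and $\mathcal B$ is a collection of copies of $K_4-e$ (called blocks) with vertices in $X$ whose edge sets partition the edge set of the complete graph $K_v$ on $X$. Two $(K_4-e)$-designs $(X,\mathcal B_1)$ and $(X,\mathcal B_2)$ are isomorphic if there is a permutation $\pi$ of $X$ with $\pi(\mathcal B_1)=\mathcal B_2$, where $\pi$ is applied to the vertices of each block. -}

module Defs where

open import Data.Fin using (Fin)
open import Data.Fin.Permutation using (Permutation′; _⟨$⟩ʳ_)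
open import Data.List using (List; []; _∷_; map; length; lookup)
open import Data.List.Membership.Propositional using (_∈_)
open import Data.List.Relation.Unary.Unique.Propositional using (Unique)
open import Data.List.Relation.Unary.Unique.Propositional.Properties using (map⁺)
import Data.List.Relation.Binary.Subset.Setoid as Subset
open import Data.Nat using (ℕ)
open import Data.Product using (_×_; _,_; ∃-syntax; ∃!)
open import Data.Sum using (_⊎_)
open import Function.Bundles using (_⇔_; Injection)
open import Function.Properties.Equivalence using (⇔-isEquivalence)
open import Function.Properties.Inverse using (Inverse⇒Injection)
open import Level using (0ℓ)
open import Relation.Binary.Bundles using (Setoid)
open import Relation.Binary.PropositionalEquality using (_≡_; _≢_)
open import Relation.Binary.Structures using (IsEquivalence)

private
  module ⇔ = IsEquivalence (⇔-isEquivalence {ℓ = 0ℓ})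

-- A copy [a,b,c-d] of K₄ - e in the complete graph on Fin v;
-- the missing edge is cd.
record Block (v : ℕ) : Set where
  constructor [_,_,_-_]⟨_⟩
  field
    a b c d  : Fin v
    distinct : Unique (a ∷ b ∷ c ∷ d ∷ [])

  edges : List (Fin v × Fin v)
  edges = (a , b) ∷ (a , c) ∷ (a , d) ∷ (b , c) ∷ (b , d) ∷ []

-- The pairs in edges are ordered, but graph edges are not.
HasEdge : ∀ {v} → Block v → Fin v → Fin v → Set
HasEdge B x y = (x , y) ∈ Block.edges B ⊎ (y , x) ∈ Block.edges B

-- Different quadruples may denote the same copy: [a,b,c-d] = [b,a,c-d] = [a,b,d-c].
-- Copies are subgraphs, and as K₄ - e has no isolated vertex, two of them
-- are equal exactly when their edge sets are.
infix 4 _≈_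
_≈_ : ∀ {v} → Block v → Block v → Set
B ≈ C = ∀ x y → HasEdge B x y ⇔ HasEdge C x y

blockSetoid : ℕ → Setoid 0ℓ 0ℓ
blockSetoid v = record
  { Carrier       = Block v
  ; _≈_           = _≈_
  ; isEquivalence = record
    { refl  = λ _ _ → ⇔.refl
    ; sym   = λ p x y → ⇔.sym (p x y)
    ; trans = λ p q x y → ⇔.trans (p x y) (q x y)
    }
  }

-- Blocks at distinct positions of the list are edge-disjoint, so it cannot
-- contain the same copy twice and stands for a set of copies.
record Design (v : ℕ) : Set where
  field
    blocks    : List (Block v)
    partition : ∀ x y → x ≢ y →
                ∃! _≡_ λ (i : Fin (length blocks)) → HasEdge (lookup blocks i) x y

permute : ∀ {v} → Permutation′ v → Block v → Block v
permute π [ a , b , c - d ]⟨ u ⟩ =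
  [ π ⟨$⟩ʳ a , π ⟨$⟩ʳ b , π ⟨$⟩ʳ c - π ⟨$⟩ʳ d ]⟨ map⁺ (Injection.injective (Inverse⇒Injection π)) u ⟩

infix 4 _≅_
_≅_ : ∀ {v} → Design v → Design v → Set
_≅_ {v} 𝓑₁ 𝓑₂ =
  ∃[ π ] (map (permute π) (blocks 𝓑₁) ⊆ blocks 𝓑₂ × blocks 𝓑₂ ⊆ map (permute π) (blocks 𝓑₁))
  where
  open Design
  open Subset (blockSetoid v) using (_⊆_)

{-# OPTIONS --safe #-}

-- In a block [a,b,c-d] call a, b its mains and c, d its sides. Name the vertices so that
-- one block is [0,1,2-3], and then keep choosing an uncovered edge xy between named
-- vertices. The block covering it is [x,y,p-q], [x,p,y-q] or [y,p,x-q], where each of p and q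
-- already has a name or may be given the least unused one. Pruning the blocks that would
-- cover an edge twice, this case distinction has about 19000 nodes, and its 10 full leaves
-- are renamings of the translates mod 11 of [0,1,3-5] or of [0,1,3-7]. In the first design
-- 0, 1 and 1, 2 are the mains of two blocks and 0, 2 the sides of a third; the second
-- design contains no such triangle.

module Submission where

open import Defs
open import Data.Bool using (Bool; true; false; T; _∧_; not; if_then_else_)
open import Data.Bool.ListAction using (all; any)
open import Data.Bool.Properties using (T-∧; T-≡; T?) renaming (_≟_ to _≟ᵇ_)
open import Data.Empty using (⊥-elim)
open import Data.Fin using (Fin; zero; suc; toℕ; fromℕ<)
open import Data.Fin.Permutation using (Permutation′; permutation; _⟨$⟩ʳ_; _⟨$⟩ˡ_; _∘ₚ_; flip; transpose; inverseˡ; inverseʳ; id)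
open import Data.Fin.Permutation.Components using () renaming (transpose to swap)
open import Data.Fin.Properties using (_≟_; all?; any?; toℕ<n; toℕ-injective; toℕ-fromℕ<)
open import Data.List using (List; []; _∷_; _++_; map; foldr; lookup; length; upTo; allFin; iterate)
import Data.List.Membership.DecPropositional as DecMembership
open import Data.List.Membership.Propositional using (_∈_; _∉_; find; lose)
open import Data.List.Membership.Propositional.Properties using (∈-map⁺; ∈-map⁻; ∈-lookup; ∈-++⁺ˡ; ∈-++⁺ʳ; ∈-++⁻; ∈-upTo⁺)
open import Data.List.Relation.Unary.All as All using (All; []; _∷_)
open import Data.List.Relation.Unary.All.Properties using (all⁺; ¬Any⇒All¬)
open import Data.List.Relation.Unary.AllPairs using ([]; _∷_; allPairs?)
open import Data.List.Relation.Unary.Any as Any using (Any; here; there; index)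
open import Data.List.Relation.Unary.Any.Properties using (any⁺; any⁻; map⁺; map⁻; lookup-index)
open import Data.List.Relation.Unary.Unique.Propositional using (Unique)
open import Data.Nat as ℕ using (ℕ; zero; suc; _+_; _⊔_; _≡ᵇ_; _<ᵇ_; _≤_; _<_; s≤s; z≤n)
open import Data.Nat.DivMod using (_mod_)
open import Data.Nat.Properties as ℕ using (≡ᵇ⇒≡; ≡⇒≡ᵇ; +-suc; +-identityʳ; <⇒<ᵇ; <ᵇ⇒<)
open import Data.Product using (_×_; _,_; proj₁; proj₂; ∃; Σ-syntax; ∃-syntax)
open import Data.Product.Properties using (≡-dec)
open import Data.Sum as Sum using (_⊎_; inj₁; inj₂; [_,_]′)
open import Data.Vec as Vec using (Vec; []; _∷_)
open import Function using (_∋_; _∘_; _⇔_; mk⇔; Equivalence)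
open import Relation.Binary.Bundles using (Setoid)
open import Relation.Binary.Definitions using (tri<; tri≈; tri>)
open import Relation.Binary.PropositionalEquality using (_≡_; _≢_; refl; sym; trans; cong; cong₂; subst; subst₂; ≢-sym)
open import Relation.Nullary using (¬_; Dec; yes; no; does; contradiction)
open import Relation.Nullary.Decidable using (True; isYes; toWitness; map′; _×-dec_; _⊎-dec_; _→-dec_; ¬?)

open Block using (distinct)
open Design using (blocks; partition)
open Equivalence using (to; from)

private variable
  v : ℕ
  A : Set

-- Blocks through the roles of their vertices

mains sides : Block v → List (Fin v)
mains B = Block.a B ∷ Block.b B ∷ []
sides B = Block.c B ∷ Block.d B ∷ []

-- Adjacency in terms of the two roles, so that it applies to vertices and to names alike. It also
-- relates each main to itself, which is why `link⇒hasEdge` asks for x ≢ y.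
Link : List A → List A → A → A → Set
Link ms ss x y = (x ∈ ms × y ∈ ms) ⊎ (x ∈ ms × y ∈ ss) ⊎ (x ∈ ss × y ∈ ms)

Link-sym : {ms ss : List A} {x y : A} → Link ms ss x y → Link ms ss y x
Link-sym (inj₁ (p , q))        = inj₁ (q , p)
Link-sym (inj₂ (inj₁ (p , q))) = inj₂ (inj₂ (q , p))
Link-sym (inj₂ (inj₂ (p , q))) = inj₂ (inj₁ (q , p))

Link-map : ∀ {A B : Set} {ms ss : List A} {ms′ ss′ : List B} {x y x′ y′} →
           (x ∈ ms → x′ ∈ ms′) → (x ∈ ss → x′ ∈ ss′) → (y ∈ ms → y′ ∈ ms′) → (y ∈ ss → y′ ∈ ss′) →
           Link ms ss x y → Link ms′ ss′ x′ y′
Link-map f g h k (inj₁ (p , q))        = inj₁ (f p , h q)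
Link-map f g h k (inj₂ (inj₁ (p , q))) = inj₂ (inj₁ (f p , k q))
Link-map f g h k (inj₂ (inj₂ (p , q))) = inj₂ (inj₂ (g p , h q))

edge⇒link : (B : Block v) {x y : Fin v} → (x , y) ∈ Block.edges B → Link (mains B) (sides B) x y
edge⇒link B (here refl)                                 = inj₁ (here refl , there (here refl))
edge⇒link B (there (here refl))                         = inj₂ (inj₁ (here refl , here refl))
edge⇒link B (there (there (here refl)))                 = inj₂ (inj₁ (here refl , there (here refl)))
edge⇒link B (there (there (there (here refl))))         = inj₂ (inj₁ (there (here refl) , here refl))
edge⇒link B (there (there (there (there (here refl))))) = inj₂ (inj₁ (there (here refl) , there (here refl)))

hasEdge⇒link : (B : Block v) {x y : Fin v} → HasEdge B x y → Link (mains B) (sides B) x y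
hasEdge⇒link B (inj₁ e) = edge⇒link B e
hasEdge⇒link B (inj₂ e) = Link-sym (edge⇒link B e)

hasEdge-sym : {B : Block v} {x y : Fin v} → HasEdge B x y → HasEdge B y x
hasEdge-sym = Sum.swap

mains∩sides : (B : Block v) {x : Fin v} → x ∈ mains B → x ∉ sides B
mains∩sides B with distinct B
... | (_ ∷ ac ∷ ad ∷ []) ∷ (bc ∷ bd ∷ []) ∷ _ = λ
  { (here refl) (here p) → ac p
  ; (here refl) (there (here p)) → ad p
  ; (there (here refl)) (here p) → bc p
  ; (there (here refl)) (there (here p)) → bd p }

edge⇒≢ : (B : Block v) {x y : Fin v} → (x , y) ∈ Block.edges B → x ≢ y
edge⇒≢ B (here refl) with distinct B
... | (ab ∷ _) ∷ _ = ab
edge⇒≢ B (there (here refl)) refl = mains∩sides B (here refl) (here refl)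
edge⇒≢ B (there (there (here refl))) refl = mains∩sides B (here refl) (there (here refl))
edge⇒≢ B (there (there (there (here refl)))) refl = mains∩sides B (there (here refl)) (here refl)
edge⇒≢ B (there (there (there (there (here refl))))) refl = mains∩sides B (there (here refl)) (there (here refl))

hasEdge⇒≢ : (B : Block v) {x y : Fin v} → HasEdge B x y → x ≢ y
hasEdge⇒≢ B (inj₁ e) = edge⇒≢ B e
hasEdge⇒≢ B (inj₂ e) = edge⇒≢ B e ∘ sym

main-side : (B : Block v) {x y : Fin v} → x ∈ mains B → y ∈ sides B → HasEdge B x y
main-side B (here refl)         (here refl)         = inj₁ (there (here refl))
main-side B (here refl)         (there (here refl)) = inj₁ (there (there (here refl)))
main-side B (there (here refl)) (here refl)         = inj₁ (there (there (there (here refl))))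
main-side B (there (here refl)) (there (here refl)) = inj₁ (there (there (there (there (here refl)))))

link⇒hasEdge : (B : Block v) {x y : Fin v} → x ≢ y → Link (mains B) (sides B) x y → HasEdge B x y
link⇒hasEdge B x≢y (inj₁ (here refl , here refl))                 = contradiction refl x≢y
link⇒hasEdge B x≢y (inj₁ (here refl , there (here refl)))         = inj₁ (here refl)
link⇒hasEdge B x≢y (inj₁ (there (here refl) , here refl))         = inj₂ (here refl)
link⇒hasEdge B x≢y (inj₁ (there (here refl) , there (here refl))) = contradiction refl x≢y
link⇒hasEdge B x≢y (inj₂ (inj₁ (p , q)))                          = main-side B p q
link⇒hasEdge B x≢y (inj₂ (inj₂ (p , q)))                          = hasEdge-sym {B = B} (main-side B q p)

sameRoles⇒≈ : {B C : Block v} → (∀ x → x ∈ mains B ⇔ x ∈ mains C) → (∀ x → x ∈ sides B ⇔ x ∈ sides C) → B ≈ C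
sameRoles⇒≈ {B = B} {C} m s x y = mk⇔
  (λ e → link⇒hasEdge C (hasEdge⇒≢ B e) (Link-map (to (m x)) (to (s x)) (to (m y)) (to (s y)) (hasEdge⇒link B e)))
  (λ e → link⇒hasEdge B (hasEdge⇒≢ C e) (Link-map (from (m x)) (from (s x)) (from (m y)) (from (s y)) (hasEdge⇒link C e)))

-- A vertex of mains B has three neighbours, one of sides C only two.
≈⇒mains : {B C : Block v} → B ≈ C → ∀ {x} → x ∈ mains B → x ∈ mains C
≈⇒mains {v} {B} {C} B≈C x∈ = go (neighbours x∈)
  where
  ThreeNeighbours : Fin v → Set
  ThreeNeighbours x = ∃[ p ] ∃[ q ] ∃[ r ]
    (p ≢ q × p ≢ r × q ≢ r × HasEdge B x p × HasEdge B x q × HasEdge B x r)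

  neighbours : ∀ {x} → x ∈ mains B → ThreeNeighbours x
  neighbours x∈ with distinct B | x∈
  ... | (ab ∷ ac ∷ ad ∷ []) ∷ (bc ∷ bd ∷ []) ∷ (cd ∷ []) ∷ _ | here refl =
    _ , _ , _ , bc , bd , cd ,
    inj₁ (here refl) , main-side B (here refl) (here refl) , main-side B (here refl) (there (here refl))
  ... | (ab ∷ ac ∷ ad ∷ []) ∷ (bc ∷ bd ∷ []) ∷ (cd ∷ []) ∷ _ | there (here refl) =
    _ , _ , _ , ac , ad , cd ,
    inj₂ (here refl) , main-side B (there (here refl)) (here refl) , main-side B (there (here refl)) (there (here refl))

  pigeonhole : ∀ {a b p q r : Fin v} → p ≢ q → p ≢ r → q ≢ r → p ∈ a ∷ b ∷ [] → q ∈ a ∷ b ∷ [] → r ∉ a ∷ b ∷ []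
  pigeonhole pq pr qr (here refl) (here refl) _ = pq refl
  pigeonhole pq pr qr (here refl) (there (here refl)) (here refl) = pr refl
  pigeonhole pq pr qr (here refl) (there (here refl)) (there (here refl)) = qr refl
  pigeonhole pq pr qr (there (here refl)) (here refl) (here refl) = qr refl
  pigeonhole pq pr qr (there (here refl)) (here refl) (there (here refl)) = pr refl
  pigeonhole pq pr qr (there (here refl)) (there (here refl)) _ = pq refl

  main-or-mains : ∀ {x y} → HasEdge B x y → x ∈ mains C ⊎ y ∈ mains C
  main-or-mains {x} {y} e with hasEdge⇒link C (to (B≈C x y) e)
  ... | inj₁ (p , _)        = inj₁ p
  ... | inj₂ (inj₁ (p , _)) = inj₁ p
  ... | inj₂ (inj₂ (_ , q)) = inj₂ q

  go : ∀ {x} → ThreeNeighbours x → x ∈ mains C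
  go (_ , _ , _ , pq , pr , qr , e , f , g) with main-or-mains e | main-or-mains f | main-or-mains g
  ... | inj₁ x | _ | _ = x
  ... | inj₂ _ | inj₁ x | _ = x
  ... | inj₂ _ | inj₂ _ | inj₁ x = x
  ... | inj₂ p | inj₂ q | inj₂ r = ⊥-elim (pigeonhole pq pr qr p q r)

≈-sym : {B C : Block v} → B ≈ C → C ≈ B
≈-sym B≈C x y = mk⇔ (from (B≈C x y)) (to (B≈C x y))

-- A side of `B` is adjacent to a main of `B`, hence is a main or a side of `C`; as a main of `C` it
-- would be a main of `B`.
≈⇒sides : {B C : Block v} → B ≈ C → ∀ {x} → x ∈ sides B → x ∈ sides C
≈⇒sides {B = B} {C} B≈C {x} x∈
  with hasEdge⇒link C (to (B≈C (Block.a B) x) (main-side B (here refl) x∈))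
... | inj₁ (_ , p)        = contradiction x∈ (mains∩sides B (≈⇒mains {B = C} {B} (≈-sym {B = B} {C} B≈C) p))
... | inj₂ (inj₁ (_ , p)) = p
... | inj₂ (inj₂ (_ , p)) = contradiction x∈ (mains∩sides B (≈⇒mains {B = C} {B} (≈-sym {B = B} {C} B≈C) p))

-- Namings of the vertices and named blocks

-- A block in terms of the names of its vertices.
record Quad : Set where
  constructor quad
  field qa qb qc qd : ℕ
  majors minors : List ℕ
  majors = qa ∷ qb ∷ []
  minors = qc ∷ qd ∷ []
open Quad using (majors; minors)

label : Permutation′ v → Fin v → ℕ
label π z = toℕ (π ⟨$⟩ʳ z)

label-injective : (π : Permutation′ v) {x y : Fin v} → label π x ≡ label π y → x ≡ y
label-injective π {x} {y} eq = trans (sym (inverseˡ π)) (trans (cong (π ⟨$⟩ˡ_) (toℕ-injective eq)) (inverseˡ π))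

-- Only membership in the roles is recorded, so the order within the mains and within the sides is
-- immaterial, as it is for copies.
record Represents (π : Permutation′ v) (q : Quad) (B : Block v) : Set where
  constructor _,_
  field
    mains⇔ : ∀ z → z ∈ mains B ⇔ label π z ∈ majors q
    sides⇔ : ∀ z → z ∈ sides B ⇔ label π z ∈ minors q

represents-link : {π : Permutation′ v} {q : Quad} {B : Block v} {x y : Fin v} → Represents π q B →
                  Link (mains B) (sides B) x y ⇔ Link (majors q) (minors q) (label π x) (label π y)
represents-link {x = x} {y} (m , s) = mk⇔
  (Link-map (to (m x)) (to (s x)) (to (m y)) (to (s y)))
  (Link-map (from (m x)) (from (s x)) (from (m y)) (from (s y)))

represents-self : (π : Permutation′ v) (B : Block v) →
                  Represents π (quad (label π (Block.a B)) (label π (Block.b B)) (label π (Block.c B)) (label π (Block.d B))) B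
represents-self π B = (λ _ → pair) , (λ _ → pair)
  where
  pair : ∀ {x y z} → z ∈ x ∷ y ∷ [] ⇔ label π z ∈ label π x ∷ label π y ∷ []
  pair = mk⇔ (∈-map⁺ (label π))
    λ { (here p) → here (label-injective π p) ; (there (here p)) → there (here (label-injective π p)) }

∈-swap : {x y z : A} → z ∈ x ∷ y ∷ [] ⇔ z ∈ y ∷ x ∷ []
∈-swap = mk⇔ sw sw
  where
  sw : {x y z : A} → z ∈ x ∷ y ∷ [] → z ∈ y ∷ x ∷ []
  sw (here p)         = there (here p)
  sw (there (here p)) = here p

infixr 4 _⟫_
_⟫_ : {A B C : Set} → A ⇔ B → B ⇔ C → A ⇔ C
f ⟫ g = mk⇔ (to g ∘ to f) (from f ∘ from g)

module _ {π : Permutation′ v} {B : Block v} {a b c d : ℕ} where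
  swap-majors : Represents π (quad a b c d) B → Represents π (quad b a c d) B
  swap-majors (m , s) = (λ z → m z ⟫ ∈-swap) , s

  swap-minors : Represents π (quad a b c d) B → Represents π (quad a b d c) B
  swap-minors (m , s) = m , (λ z → s z ⟫ ∈-swap)

-- The positions of the edge uw in a block with other vertices P and Q.
record Around (B : Block v) (u w : Fin v) : Set where
  field
    P Q : Fin v
    u≢P : u ≢ P
    u≢Q : u ≢ Q
    w≢P : w ≢ P
    w≢Q : w ≢ Q
    P≢Q : P ≢ Q
    role : (π : Permutation′ v) →
           Represents π (quad (label π u) (label π w) (label π P) (label π Q)) B
         ⊎ Represents π (quad (label π u) (label π P) (label π w) (label π Q)) B
         ⊎ Represents π (quad (label π w) (label π P) (label π u) (label π Q)) B

-- If the edge joins the mains, P and Q are the sides; otherwise P is the other main and Q the other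
-- side. Reversing the edge exchanges the last two roles. `role` speaks of all namings because P and
-- Q get their names only after they are found.
around : (B : Block v) {x y : Fin v} → HasEdge B x y → Around B x y
around B (inj₂ e) = record
  { P = P ; Q = Q ; u≢P = w≢P ; u≢Q = w≢Q ; w≢P = u≢P ; w≢Q = u≢Q ; P≢Q = P≢Q
  ; role = λ π → [ inj₁ ∘ swap-majors , inj₂ ∘ Sum.swap ]′ (role π) }
  where open Around (around B (inj₁ e))
around B (inj₁ e) with distinct B | e
... | (ab ∷ ac ∷ ad ∷ []) ∷ (bc ∷ bd ∷ []) ∷ (cd ∷ []) ∷ _ | here refl = record
  { u≢P = ac ; u≢Q = ad ; w≢P = bc ; w≢Q = bd ; P≢Q = cd ; role = λ π → inj₁ (represents-self π B) }
... | (ab ∷ ac ∷ ad ∷ []) ∷ (bc ∷ bd ∷ []) ∷ (cd ∷ []) ∷ _ | there (here refl) = record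
  { u≢P = ab ; u≢Q = ad ; w≢P = ≢-sym bc ; w≢Q = cd ; P≢Q = bd
  ; role = λ π → inj₂ (inj₁ (represents-self π B)) }
... | (ab ∷ ac ∷ ad ∷ []) ∷ (bc ∷ bd ∷ []) ∷ (cd ∷ []) ∷ _ | there (there (here refl)) = record
  { u≢P = ab ; u≢Q = ac ; w≢P = ≢-sym bd ; w≢Q = ≢-sym cd ; P≢Q = bc
  ; role = λ π → inj₂ (inj₁ (swap-minors (represents-self π B))) }
... | (ab ∷ ac ∷ ad ∷ []) ∷ (bc ∷ bd ∷ []) ∷ (cd ∷ []) ∷ _ | there (there (there (here refl))) = record
  { u≢P = ≢-sym ab ; u≢Q = bd ; w≢P = ≢-sym ac ; w≢Q = cd ; P≢Q = ad
  ; role = λ π → inj₂ (inj₁ (swap-majors (represents-self π B))) }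
... | (ab ∷ ac ∷ ad ∷ []) ∷ (bc ∷ bd ∷ []) ∷ (cd ∷ []) ∷ _ | there (there (there (there (here refl)))) = record
  { u≢P = ≢-sym ab ; u≢Q = bc ; w≢P = ≢-sym ad ; w≢Q = ≢-sym cd ; P≢Q = ac
  ; role = λ π → inj₂ (inj₁ (swap-majors (swap-minors (represents-self π B)))) }

-- Tables of uncovered edges

infix 8 _∈ᵇ_
_∈ᵇ_ : ℕ → List ℕ → Bool
x ∈ᵇ xs = any (x ≡ᵇ_) xs

∈ᵇ⇔∈ : ∀ {x xs} → T (x ∈ᵇ xs) ⇔ x ∈ xs
∈ᵇ⇔∈ {x} {xs} = mk⇔ (Any.map (≡ᵇ⇒≡ x _) ∘ any⁻ (x ≡ᵇ_) xs) (any⁺ (x ≡ᵇ_) ∘ Any.map (≡⇒≡ᵇ x _))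

-- Bit y of row x tells whether xy is an uncovered edge; bits out of range are false.
Row Table : Set
Row   = List Bool
Table = List Row

bit : Row → ℕ → Bool
bit []      _       = false
bit (b ∷ r) zero    = b
bit (b ∷ r) (suc n) = bit r n

row : Table → ℕ → Row
row []      _       = []
row (r ∷ t) zero    = r
row (r ∷ t) (suc n) = row t n

free : Table → ℕ → ℕ → Bool
free t x y = bit (row t x) y

-- `n` is the index of the head of the row. Bits that are already false skip the membership test.
strike : ℕ → List ℕ → Row → Row
strike n ns []          = []
strike n ns (true  ∷ r) = not (n ∈ᵇ ns) ∷ strike (suc n) ns r
strike n ns (false ∷ r) = false ∷ strike (suc n) ns r

-- A major is listed among its own neighbours, in accordance with `Link`; the diagonal of
-- `emptyTable` is false anyway.
neighbours : Quad → ℕ → List ℕ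
neighbours q x = if x ∈ᵇ majors q then majors q ++ minors q
                 else if x ∈ᵇ minors q then majors q else []

strikeAll : ℕ → Quad → Table → Table
strikeAll n q []      = []
strikeAll n q (r ∷ t) = strike 0 (neighbours q n) r ∷ strikeAll (suc n) q t

emptyTable : Table
emptyTable = map (λ x → map (λ y → not (x ≡ᵇ y)) (upTo 11)) (upTo 11)

tableOf : List Quad → Table
tableOf = foldr (strikeAll 0) emptyTable

not-∈ᵇ : ∀ {x xs} → T (not (x ∈ᵇ xs)) ⇔ x ∉ xs
not-∈ᵇ {x} {xs} with x ∈ᵇ xs in eq
... | true  = mk⇔ (λ ()) (λ x∉ → x∉ (to ∈ᵇ⇔∈ (from T-≡ eq)))
... | false = mk⇔ (λ _ x∈ → subst T eq (from ∈ᵇ⇔∈ x∈)) _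

bit-strike : ∀ n ns r y → T (bit (strike n ns r) y) ⇔ (T (bit r y) × n + y ∉ ns)
bit-strike n ns []          y       = mk⇔ (λ ()) proj₁
bit-strike n ns (true  ∷ r) zero    rewrite +-identityʳ n = mk⇔ (λ h → _ , to not-∈ᵇ h) (from not-∈ᵇ ∘ proj₂)
bit-strike n ns (false ∷ r) zero    = mk⇔ (λ ()) proj₁
bit-strike n ns (true  ∷ r) (suc y) rewrite +-suc n y = bit-strike (suc n) ns r y
bit-strike n ns (false ∷ r) (suc y) rewrite +-suc n y = bit-strike (suc n) ns r y

free-strikeAll : ∀ n q t x y → T (free (strikeAll n q t) x y) ⇔ (T (free t x y) × y ∉ neighbours q (n + x))
free-strikeAll n q []      x       y = mk⇔ (λ ()) proj₁
free-strikeAll n q (r ∷ t) zero    y rewrite +-identityʳ n = bit-strike 0 (neighbours q n) r y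
free-strikeAll n q (r ∷ t) (suc x) y rewrite +-suc n x = free-strikeAll (suc n) q t x y

Linked : Quad → ℕ → ℕ → Set
Linked q = Link (majors q) (minors q)

neighbours-linked : ∀ q x y → y ∈ neighbours q x ⇔ Linked q x y
neighbours-linked q x y with x ∈ᵇ majors q in eq
... | true = mk⇔ ([ (λ y∈ → inj₁ (x∈ , y∈)) , (λ y∈ → inj₂ (inj₁ (x∈ , y∈))) ]′ ∘ ∈-++⁻ (majors q))
                 [ ∈-++⁺ˡ ∘ proj₂ , [ ∈-++⁺ʳ (majors q) ∘ proj₂ , ∈-++⁺ˡ ∘ proj₂ ]′ ]′
  where x∈ = to ∈ᵇ⇔∈ (from T-≡ eq)
... | false with x ∈ᵇ minors q in eq′
...   | true  = mk⇔ (λ y∈ → inj₂ (inj₂ (to ∈ᵇ⇔∈ (from T-≡ eq′) , y∈)))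
                    [ (λ p → contradiction (proj₁ p) x∉) , [ (λ p → contradiction (proj₁ p) x∉) , proj₂ ]′ ]′
  where x∉ = λ x∈ → subst T eq (from ∈ᵇ⇔∈ x∈)
...   | false = mk⇔ (λ ())
                    [ (λ p → contradiction (proj₁ p) x∉) ,
                      [ (λ p → contradiction (proj₁ p) x∉) , (λ p → contradiction (proj₁ p) x∉′) ]′ ]′
  where
  x∉  = λ x∈ → subst T eq (from ∈ᵇ⇔∈ x∈)
  x∉′ = λ x∈ → subst T eq′ (from ∈ᵇ⇔∈ x∈)

free-empty : (x y : Fin 11) → free emptyTable (toℕ x) (toℕ y) ≡ not (does (x ≟ y))
free-empty = toWitness {a? = all? λ x → all? λ y → _ ≟ᵇ _} _

-- Each `strikeAll` clears exactly the pairs linked by its quad, and `emptyTable` accounts for x ≢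
-- y. Soundness of the search rests on this description.
free-tableOf : ∀ cs (x y : Fin 11) →
               T (free (tableOf cs) (toℕ x) (toℕ y)) ⇔ (x ≢ y × All (λ q → ¬ Linked q (toℕ x) (toℕ y)) cs)
free-tableOf [] x y rewrite free-empty x y with x ≟ y
... | yes x≡y = mk⇔ (λ ()) (λ p → proj₁ p x≡y)
... | no  x≢y = mk⇔ (λ _ → x≢y , []) _
free-tableOf (q ∷ cs) x y = mk⇔
  (λ h → let (h′ , y∉) = to step h ; (x≢y , ps) = to (free-tableOf cs x y) h′
         in x≢y , (y∉ ∘ from (neighbours-linked q _ _)) ∷ ps)
  (λ { (x≢y , p ∷ ps) → from step (from (free-tableOf cs x y) (x≢y , ps) , p ∘ to (neighbours-linked q _ _)) })
  where step = free-strikeAll 0 q (tableOf cs) (toℕ x) (toℕ y)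

-- The choice of the edge is a heuristic without any specification: the search checks again
-- what it needs of the edge. An edge is better if its ends have fewer common uncovered
-- neighbours, as any block covering it uses one of these.
common : Row → Row → ℕ
common (true ∷ r) (true ∷ s) = suc (common r s)
common (_    ∷ r) (_    ∷ s) = common r s
common _          _          = 0

data Best : Set where
  none : Best
  best : (score x y : ℕ) → Best

better : ℕ → ℕ → ℕ → Best → Best
better n x y none         = best n x y
better n x y (best m u w) = if n <ᵇ m then best n x y else best m u w

-- Row x comes twice: `r` stays whole for the comparison with row y, while the bits `b` are read in
-- step with the rows `s` of the table. Stopping at y = x visits each unordered pair once.
pickInRow : ℕ → Row → ℕ → Row → Table → Best → Best
pickInRow x r y (b ∷ bs) (s ∷ t) acc =
  if y <ᵇ x then pickInRow x r (suc y) bs t (if b then better (common r s) y x acc else acc) else acc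
pickInRow x r y _ _ acc = acc

pickBelow : ℕ → Table → ℕ → Table → Best → Best
pickBelow k t x (r ∷ rs) acc = if x <ᵇ k then pickBelow k t (suc x) rs (pickInRow x r 0 r t acc) else acc
pickBelow k t x []       acc = acc

pick : ℕ → Table → Best
pick k t = pickBelow k t 0 t none

-- This does the pruning: the subtree `c` is left unevaluated where the guard fails.
infixr 5 _⇒ᵇ_
_⇒ᵇ_ : Bool → Bool → Bool
true  ⇒ᵇ c = c
false ⇒ᵇ c = true

T-⇒ : ∀ {b c} → T (b ⇒ᵇ c) → T b → T c
T-⇒ {true} h _ = h

-- Renaming vertices that have no name yet

-- Both labellings use the labels below k for the same vertices.
Agree : ℕ → Permutation′ v → Permutation′ v → Set
Agree k π π′ = ∀ z → label π′ z ≡ label π z ⊎ (k ≤ label π z × k ≤ label π′ z)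

agree-below : ∀ {k} {π π′ : Permutation′ v} → Agree k π π′ → ∀ {z} → label π z < k → label π′ z ≡ label π z
agree-below ag {z} l<k with ag z
... | inj₁ eq        = eq
... | inj₂ (k≤l , _) = contradiction l<k (ℕ.≤⇒≯ k≤l)

-- The name of z is exchanged with k; both are at least k, so no smaller name moves.
relabel : (π : Permutation′ v) (k : ℕ) (z : Fin v) → k ≤ label π z →
          Σ[ π′ ∈ Permutation′ v ] label π′ z ≡ k × Agree k π π′
relabel {v} π k z k≤l = π ∘ₚ transpose i j , at-z , agree
  where
  i j : Fin v
  i = π ⟨$⟩ʳ z
  j = fromℕ< (ℕ.≤-<-trans k≤l (toℕ<n i))

  j≡k : toℕ j ≡ k
  j≡k = toℕ-fromℕ< _

  at-z : toℕ (swap i j i) ≡ k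
  at-z with i ≟ i
  ... | yes _  = j≡k
  ... | no i≢i = contradiction refl i≢i

  agree : Agree k π (π ∘ₚ transpose i j)
  agree w with (π ⟨$⟩ʳ w) ≟ i
  ... | yes eq = inj₂ (ℕ.≤-trans k≤l (ℕ.≤-reflexive (cong toℕ (sym eq))) , ℕ.≤-reflexive (sym j≡k))
  ... | no _ with (π ⟨$⟩ʳ w) ≟ j
  ...   | yes eq = inj₂ (ℕ.≤-reflexive (sym (trans (cong toℕ eq) j≡k)) , k≤l)
  ...   | no _   = inj₁ refl

settle : (π : Permutation′ v) (k : ℕ) (z : Fin v) →
         Σ[ π′ ∈ Permutation′ v ] label π′ z ≤ k × Agree k π π′
settle π k z with label π z ℕ.<? k
... | yes l<k = π , ℕ.<⇒≤ l<k , λ _ → inj₁ refl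
... | no  l≮k with relabel π k z (ℕ.≮⇒≥ l≮k)
...   | π′ , eq , ag = π′ , ℕ.≤-reflexive eq , ag

agree-weaken : ∀ {k k′} {π π′ : Permutation′ v} → k ≤ k′ → Agree k′ π π′ → Agree k π π′
agree-weaken k≤k′ ag z = Sum.map₂ (λ (p , q) → ℕ.≤-trans k≤k′ p , ℕ.≤-trans k≤k′ q) (ag z)

Below : ℕ → Quad → Set
Below k q = All (_< k) (majors q) × All (_< k) (minors q)

below-weaken : ∀ {k k′ q} → k ≤ k′ → Below k q → Below k′ q
below-weaken k≤k′ (m , s) = All.map (λ p → ℕ.<-≤-trans p k≤k′) m , All.map (λ p → ℕ.<-≤-trans p k≤k′) s

-- A vertex whose name changes has a name of at least k before and after, so it occurs in no quad
-- below k.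
represents-agree : ∀ {k q} {π π′ : Permutation′ v} {B : Block v} → Agree k π π′ → Below k q →
                   Represents π q B → Represents π′ q B
represents-agree {k = k} {π = π} {π′} ag (bm , bs) (m , s) = (λ z → m z ⟫ move bm z) , (λ z → s z ⟫ move bs z)
  where
  move : ∀ {xs} → All (_< k) xs → ∀ z → label π z ∈ xs ⇔ label π′ z ∈ xs
  move b z with ag z
  ... | inj₁ eq      = mk⇔ (subst (_∈ _) (sym eq)) (subst (_∈ _) eq)
  ... | inj₂ (p , q) = mk⇔ (λ x∈ → contradiction (All.lookup b x∈) (ℕ.≤⇒≯ p))
                           (λ x∈ → contradiction (All.lookup b x∈) (ℕ.≤⇒≯ q))

-- Designs matching the same list of quads are isomorphic

module _ {n : ℕ} where
  open DecMembership (_≟_ {n}) public using () renaming (_∈?_ to _∈ᶠ?_)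
open DecMembership ℕ._≟_ using (_∈?_)

_⇔?_ : ∀ {A B : Set} → Dec A → Dec B → Dec (A ⇔ B)
a? ⇔? b? = map′ (λ (f , g) → mk⇔ f g) (λ e → to e , from e) ((a? →-dec b?) ×-dec (b? →-dec a?))

represents? : (π : Permutation′ v) (q : Quad) (B : Block v) → Dec (Represents π q B)
represents? π q B = map′ (λ (m , s) → m , s) (λ (m , s) → m , s)
  (all? (λ z → (z ∈ᶠ? mains B) ⇔? (label π z ∈? majors q)) ×-dec all? (λ z → (z ∈ᶠ? sides B) ⇔? (label π z ∈? minors q)))

Matches : List Quad → Design v → Permutation′ v → Set
Matches cs 𝓓 π = All (λ q → Any (Represents π q) (blocks 𝓓)) cs
               × All (λ B → Any (λ q → Represents π q B) cs) (blocks 𝓓)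

matches? : (cs : List Quad) (𝓓 : Design v) (π : Permutation′ v) → Dec (Matches cs 𝓓 π)
matches? cs 𝓓 π = All.all? (λ q → Any.any? (represents? π q) (blocks 𝓓)) cs
            ×-dec All.all? (λ B → Any.any? (λ q → represents? π q B) cs) (blocks 𝓓)

transport⇔ : {x y : A} {xs : List A} → x ≡ y → x ∈ xs ⇔ y ∈ xs
transport⇔ refl = mk⇔ (λ p → p) (λ p → p)

-- `π ∘ₚ flip τ` sends each vertex to the one that has under τ the name it has under π, so the names
-- in a block survive.
represents-permute : (π τ : Permutation′ v) {q : Quad} {B : Block v} → Represents π q B →
                     Represents τ q (permute (π ∘ₚ flip τ) B)
represents-permute {v} π τ (m , s) =
  (λ z → pull ⟫ m (σ ⟨$⟩ˡ z) ⟫ transport⇔ (label-pull z)) , (λ z → pull ⟫ s (σ ⟨$⟩ˡ z) ⟫ transport⇔ (label-pull z))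
  where
  σ : Permutation′ v
  σ = π ∘ₚ flip τ

  label-pull : ∀ z → label π (σ ⟨$⟩ˡ z) ≡ label τ z
  label-pull z = cong toℕ (inverseʳ π)

  pull : ∀ {z xs} → z ∈ map (σ ⟨$⟩ʳ_) xs ⇔ (σ ⟨$⟩ˡ z) ∈ xs
  pull {z} {xs} = mk⇔
    (λ z∈ → let (w , w∈ , eq) = ∈-map⁻ (σ ⟨$⟩ʳ_) z∈
            in subst (_∈ xs) (sym (trans (cong (σ ⟨$⟩ˡ_) eq) (inverseˡ σ))) w∈)
    (λ w∈ → subst (_∈ _) (inverseʳ σ) (∈-map⁺ (σ ⟨$⟩ʳ_) w∈))

represents⇒≈ : {π : Permutation′ v} {q : Quad} {B C : Block v} → Represents π q B → Represents π q C → B ≈ C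
represents⇒≈ {B = B} {C} (m , s) (m′ , s′) = sameRoles⇒≈ {B = B} {C} (λ x → both (m x) (m′ x)) (λ x → both (s x) (s′ x))
  where
  both : ∀ {A B C : Set} → A ⇔ C → B ⇔ C → A ⇔ B
  both f g = mk⇔ (from g ∘ to f) (from f ∘ to g)

module _ {cs : List Quad} {𝓓 𝓔 : Design v} {π τ : Permutation′ v}
         (mπ : Matches cs 𝓓 π) (mτ : Matches cs 𝓔 τ) where
  private
    module S = Setoid (blockSetoid v)

    σ : Permutation′ v
    σ = π ∘ₚ flip τ

    transfer : ∀ {q B C} → Represents π q B → Represents τ q C → permute σ B ≈ C
    transfer {q} {B} {C} r r′ = represents⇒≈ {π = τ} {q} {permute σ B} {C} (represents-permute π τ r) r′

  -- Each block of one design is represented by a quad of `cs`, which also represents a block of the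
  -- other.
  matches⇒≅ : 𝓓 ≅ 𝓔
  matches⇒≅ = σ , (λ {X} → forth {X}) , (λ {X} → back {X})
    where
    forth : ∀ {X} → Any (X ≈_) (map (permute σ) (blocks 𝓓)) → Any (X ≈_) (blocks 𝓔)
    forth {X} X∈ with find (map⁻ X∈)
    ... | B , B∈ , X≈ with find (All.lookup (proj₂ mπ) B∈)
    ... | q , q∈ , r with find (All.lookup (proj₁ mτ) q∈)
    ... | C , C∈ , r′ = lose C∈ (S.trans {X} {permute σ B} {C} X≈ (transfer {q} {B} {C} r r′))

    back : ∀ {X} → Any (X ≈_) (blocks 𝓔) → Any (X ≈_) (map (permute σ) (blocks 𝓓))
    back {X} X∈ with find X∈
    ... | C , C∈ , X≈ with find (All.lookup (proj₂ mτ) C∈)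
    ... | q , q∈ , r with find (All.lookup (proj₁ mπ) q∈)
    ... | B , B∈ , r′ = map⁺ (lose B∈
      (S.trans {X} {C} {permute σ B} X≈ (S.sym {permute σ B} {C} (transfer {q} {B} {C} r′ r))))

-- The two cyclic designs

hasEdge? : (B : Block v) (x y : Fin v) → Dec (HasEdge B x y)
hasEdge? B x y = (x , y) ∈₂? Block.edges B ⊎-dec (y , x) ∈₂? Block.edges B
  where open DecMembership (≡-dec _≟_ _≟_) renaming (_∈?_ to _∈₂?_)

-- The field `partition` with the implicit argument of `∃!` made explicit, so that finite search
-- decides it.
Partitions : List (Block v) → Set
Partitions bs = ∀ x y → x ≢ y →
  ∃ λ (i : Fin (length bs)) → HasEdge (lookup bs i) x y × (∀ j → HasEdge (lookup bs j) x y → i ≡ j)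

partitions? : (bs : List (Block v)) → Dec (Partitions bs)
partitions? bs = all? λ x → all? λ y → ¬? (x ≟ y) →-dec any? λ i →
  hasEdge? (lookup bs i) x y ×-dec all? λ j → hasEdge? (lookup bs j) x y →-dec i ≟ j

design : (bs : List (Block v)) → Partitions bs → Design v
design bs p = record
  { blocks    = bs
  ; partition = λ x y x≢y → let (i , e , u) = p x y x≢y in i , e , λ {j} → u j }

translates : ℕ → ℕ → Fin 11 → List (Fin 11)
translates c d i = map (λ n → (toℕ i + n) mod 11) (0 ∷ 1 ∷ c ∷ d ∷ [])

unique? : (xs : List (Fin v)) → Dec (Unique xs)
unique? = allPairs? λ x y → ¬? (x ≟ y)

cyclicBlocks : (c d : ℕ) → (∀ i → Unique (translates c d i)) → List (Block 11)
cyclicBlocks c d u = map (λ i → [ _ , _ , _ - _ ]⟨ u i ⟩) (allFin 11)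

-- Up to sign mod 11, the edges of [0,1,3-5] have the differences 1, 3, 5, 2, 4 and those of
-- [0,1,3-7] have 1, 3, 4, 2, 5. Every difference from 1 to 5 occurs once, so the translates
-- partition the edges.
blocks₁ blocks₂ : List (Block 11)
blocks₁ = cyclicBlocks 3 5 (toWitness {a? = all? λ _ → unique? _} _)
blocks₂ = cyclicBlocks 3 7 (toWitness {a? = all? λ _ → unique? _} _)

𝓓₁ 𝓓₂ : Design 11
𝓓₁ = design blocks₁ (toWitness {a? = partitions? blocks₁} _)
𝓓₂ = design blocks₂ (toWitness {a? = partitions? blocks₂} _)

-- Evaluation decides both inverse laws: the search for preimages yields one, and `l` is the other.
module _ (f : Fin v → Fin v) (s : True (all? λ y → any? λ x → f x ≟ y)) where
  preimage : Fin v → Fin v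
  preimage y = proj₁ (toWitness s y)

  bijection : True (all? λ x → preimage (f x) ≟ x) → Permutation′ v
  bijection l = permutation f preimage (λ y → proj₂ (toWitness s y)) (toWitness l)

table : Vec ℕ 11 → Fin 11 → Fin 11
table xs i = Vec.lookup xs i mod 11

-- Vertex i of the design is named by entry i; there is one table per leaf of the search.
relabellings₁ relabellings₂ : List (Permutation′ 11)
relabellings₁ =
  bijection (table (1 ∷ 0 ∷ 4 ∷ 2 ∷ 6 ∷ 3 ∷ 7 ∷ 5 ∷ 9 ∷ 10 ∷ 8 ∷ [])) _ _ ∷
  bijection (table (1 ∷ 0 ∷ 4 ∷ 2 ∷ 7 ∷ 3 ∷ 6 ∷ 5 ∷ 9 ∷ 10 ∷ 8 ∷ [])) _ _ ∷
  bijection (table (0 ∷ 1 ∷ 4 ∷ 2 ∷ 7 ∷ 3 ∷ 8 ∷ 5 ∷ 10 ∷ 9 ∷ 6 ∷ [])) _ _ ∷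
  bijection (table (1 ∷ 0 ∷ 4 ∷ 3 ∷ 6 ∷ 2 ∷ 7 ∷ 5 ∷ 9 ∷ 10 ∷ 8 ∷ [])) _ _ ∷
  bijection (table (1 ∷ 0 ∷ 4 ∷ 3 ∷ 7 ∷ 2 ∷ 6 ∷ 5 ∷ 9 ∷ 10 ∷ 8 ∷ [])) _ _ ∷
  bijection (table (0 ∷ 1 ∷ 4 ∷ 3 ∷ 7 ∷ 2 ∷ 8 ∷ 5 ∷ 10 ∷ 9 ∷ 6 ∷ [])) _ _ ∷ []
relabellings₂ =
  bijection (table (1 ∷ 0 ∷ 6 ∷ 3 ∷ 7 ∷ 9 ∷ 10 ∷ 2 ∷ 4 ∷ 8 ∷ 5 ∷ [])) _ _ ∷
  bijection (table (0 ∷ 1 ∷ 8 ∷ 3 ∷ 7 ∷ 9 ∷ 10 ∷ 2 ∷ 4 ∷ 6 ∷ 5 ∷ [])) _ _ ∷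
  bijection (table (1 ∷ 0 ∷ 6 ∷ 2 ∷ 7 ∷ 9 ∷ 10 ∷ 3 ∷ 4 ∷ 8 ∷ 5 ∷ [])) _ _ ∷
  bijection (table (0 ∷ 1 ∷ 8 ∷ 2 ∷ 7 ∷ 9 ∷ 10 ∷ 3 ∷ 4 ∷ 6 ∷ 5 ∷ [])) _ _ ∷ []

-- An invariant that separates the two designs

Mains Sides : Design v → Fin v → Fin v → Set
Mains 𝓓 x y = Any (λ B → x ∈ mains B × y ∈ mains B) (blocks 𝓓)
Sides 𝓓 x y = Any (λ B → x ∈ sides B × y ∈ sides B) (blocks 𝓓)

mains? : (𝓓 : Design v) → ∀ x y → Dec (Mains 𝓓 x y)
mains? 𝓓 x y = Any.any? (λ B → x ∈ᶠ? mains B ×-dec y ∈ᶠ? mains B) (blocks 𝓓)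

sides? : (𝓓 : Design v) → ∀ x y → Dec (Sides 𝓓 x y)
sides? 𝓓 x y = Any.any? (λ B → x ∈ᶠ? sides B ×-dec y ∈ᶠ? sides B) (blocks 𝓓)

module Image (𝓓 𝓔 : Design v) (iso : 𝓓 ≅ 𝓔) where
  private
    π : Permutation′ v
    π = proj₁ iso

    image : ∀ {P : Block v → Set} {R : Block v → Set} →
            (∀ {B C} → permute π B ≈ C → P B → R C) → Any P (blocks 𝓓) → Any R (blocks 𝓔)
    image f p with find p
    ... | B , B∈ , pB
      with find (proj₁ (proj₂ iso) {permute π B} (map⁺ (lose B∈ (Setoid.refl (blockSetoid v) {permute π B}))))
    ... | C , C∈ , B≈C = lose C∈ (f {B} {C} B≈C pB)

  -- By `≈⇒mains` the mains depend only on the copy and not on the quadruple denoting it, so an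
  -- isomorphism preserves them.
  ≅-mains : ∀ {x y} → Mains 𝓓 x y → Mains 𝓔 (π ⟨$⟩ʳ x) (π ⟨$⟩ʳ y)
  ≅-mains = image λ {B} {C} B≈C (p , q) →
    ≈⇒mains {B = permute π B} {C} B≈C (∈-map⁺ _ p) , ≈⇒mains {B = permute π B} {C} B≈C (∈-map⁺ _ q)

  ≅-sides : ∀ {x y} → Sides 𝓓 x y → Sides 𝓔 (π ⟨$⟩ʳ x) (π ⟨$⟩ʳ y)
  ≅-sides = image λ {B} {C} B≈C (p , q) →
    ≈⇒sides {B = permute π B} {C} B≈C (∈-map⁺ _ p) , ≈⇒sides {B = permute π B} {C} B≈C (∈-map⁺ _ q)

-- Mod 11, two mains of a block of `𝓓₂` differ by 0 or ±1 and two sides by 0 or ±4, while a sum of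
-- two numbers from 0, ±1 is never ±4. The case x = z does occur, since both relations admit equal
-- vertices.
no-triangle₂ : ∀ x y z → Mains 𝓓₂ x y → Mains 𝓓₂ y z → Sides 𝓓₂ x z → x ≡ z
no-triangle₂ = toWitness {a? = all? λ x → all? λ y → all? λ z →
  mains? 𝓓₂ x y →-dec mains? 𝓓₂ y z →-dec sides? 𝓓₂ x z →-dec x ≟ z} _

𝓓₁≇𝓓₂ : ¬ (𝓓₁ ≅ 𝓓₂)
𝓓₁≇𝓓₂ iso = contradiction
  (label-injective (proj₁ iso) (cong toℕ (no-triangle₂ _ _ _ (≅-mains m₀₁) (≅-mains m₁₂) (≅-sides s₀₂)))) λ ()
  where
  open Image 𝓓₁ 𝓓₂ iso
  m₀₁ : Mains 𝓓₁ zero (suc zero)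
  m₀₁ = toWitness {a? = mains? 𝓓₁ _ _} _
  m₁₂ : Mains 𝓓₁ (suc zero) (suc (suc zero))
  m₁₂ = toWitness {a? = mains? 𝓓₁ _ _} _
  -- The block is [8,9,0-2], the translate by 8.
  s₀₂ : Sides 𝓓₁ zero (suc (suc zero))
  s₀₂ = toWitness {a? = sides? 𝓓₁ _ _} _

-- The search and its soundness

linked? : ∀ q x y → Dec (Linked q x y)
linked? q x y = (x ∈? majors q ×-dec y ∈? majors q)
          ⊎-dec (x ∈? majors q ×-dec y ∈? minors q)
          ⊎-dec (x ∈? minors q ×-dec y ∈? majors q)

Full : Table → Set
Full t = (x y : Fin 11) → ¬ T (free t (toℕ x) (toℕ y))

≢⇒T-not : ∀ {m n} → m ≢ n → T (not (m ≡ᵇ n))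
≢⇒T-not {m} {n} m≢n with m ≡ᵇ n in eq
... | true  = m≢n (≡ᵇ⇒≡ m n (from T-≡ eq))
... | false = _

full? : (t : Table) → Dec (Full t)
full? t = all? λ x → all? λ y → ¬? (T? _)

T-if : ∀ {b c d} → T (if b then c else d) → (T b × T c) ⊎ (¬ T b × T d)
T-if {true}  h = inj₁ (_ , h)
T-if {false} h = inj₂ ((λ ()) , h)

labelled : (π : Permutation′ v) {x : ℕ} → x < v → ∃ λ z → label π z ≡ x
labelled π x<v = π ⟨$⟩ˡ fromℕ< x<v , trans (cong toℕ (inverseʳ π)) (toℕ-fromℕ< x<v)

-- In search n k cs t, the names in use are those below k, cs lists the blocks chosen so far,
-- t is tableOf cs, and n bounds the depth. As [x,y,p-q] = [x,y,q-p], only p < q is tried.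
module Search (accept : List Quad → Bool) where
  search : ℕ → ℕ → List Quad → Table → Bool
  branch : ℕ → ℕ → List Quad → Table → Best → Bool
  children : ℕ → ℕ → List Quad → Table → (x y : ℕ) → Bool
  child : ℕ → ℕ → List Quad → Table → (x y p : ℕ) → Bool
  complete opposite adjacent : ℕ → ℕ → List Quad → Table → (x y p q : ℕ) → Bool
  extend : ℕ → ℕ → List Quad → Table → Quad → Bool

  search zero    k cs t = false
  search (suc n) k cs t = branch n k cs t (pick k t)

  -- When no edge is proposed, one more vertex is named. Once all 11 are named, `full?` checks that
  -- nothing is left uncovered, which `pick` does not guarantee.
  branch n k cs t none = if k ≡ᵇ 11 then isYes (full? t) ∧ accept cs else search n (suc k) cs t
  branch n k cs t (best _ x y) =
    ((x <ᵇ k) ∧ (y <ᵇ k) ∧ free t x y) ∧ children n k cs t x y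

  children n k cs t x y = all (child n k cs t x y) (upTo (suc k))

  child n k cs t x y p = (free t x p ∧ free t y p) ⇒ᵇ all (complete n k cs t x y p) (upTo (suc (k ⊔ suc p)))

  complete n k cs t x y p q = opposite n k cs t x y p q ∧ adjacent n k cs t x y p q ∧ adjacent n k cs t y x p q

  opposite n k cs t x y p q =
    ((p <ᵇ q) ∧ free t x q ∧ free t y q) ⇒ᵇ extend n (k ⊔ suc p ⊔ suc q) cs t (quad x y p q)

  adjacent n k cs t x y p q =
    -- Here yq is the missing edge, so the table does not rule out q = y; the other coincidences
    -- fail on its diagonal.
    (not (q ≡ᵇ y) ∧ free t x q ∧ free t p q) ⇒ᵇ extend n (k ⊔ suc p ⊔ suc q) cs t (quad x p y q)

  extend n k cs t q = search n k (q ∷ cs) (strikeAll 0 q t)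

  -- The design 𝓓 guides a descent through the search tree. Its vertices are named so that all
  -- chosen quads represent blocks of 𝓓, and the block covering the chosen edge tells which child to
  -- enter. The leaf reached matches 𝓓.
  module Soundness (𝓓 : Design 11) (Goal : Set)
                   (conclude : ∀ {cs π} → Matches cs 𝓓 π → T (accept cs) → Goal) where
    private
      B : Fin (length (blocks 𝓓)) → Block 11
      B = lookup (blocks 𝓓)

      variable
        k : ℕ
        cs : List Quad
        π : Permutation′ 11
        u w : Fin 11

    Placed : Permutation′ 11 → ℕ → List Quad → Set
    Placed π k = All λ q → Below k q × ∃ λ i → Represents π q (B i)

    same-block : ∀ {i j} → HasEdge (B i) u w → HasEdge (B j) u w → i ≡ j
    same-block {i = i} e f with partition 𝓓 _ _ (hasEdge⇒≢ (B i) e)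
    ... | _ , _ , unique = trans (sym (unique e)) (unique f)

    represented-edge : ∀ {q i} → Represents π q (B i) → u ≢ w → Linked q (label π u) (label π w) → HasEdge (B i) u w
    represented-edge {i = i} r u≢w l = link⇒hasEdge (B i) u≢w (from (represents-link r) l)

    Free : Permutation′ 11 → List Quad → Fin 11 → Fin 11 → Set
    Free π cs u w = T (free (tableOf cs) (label π u) (label π w))

    -- A block with an uncovered edge is not among the chosen ones.
    free-block : ∀ {i P Q} → Placed π k cs → HasEdge (B i) u w → Free π cs u w → HasEdge (B i) P Q → Free π cs P Q
    free-block {π} {k} {cs} {u} {w} {i} {P} {Q} pl e fr f =
      from (free-tableOf cs (π ⟨$⟩ʳ P) (π ⟨$⟩ʳ Q)) (P≢Q ∘ label-injective π ∘ cong toℕ , All.zipWith other (pl , unlinked))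
      where
      P≢Q : P ≢ Q
      P≢Q = hasEdge⇒≢ (B i) f
      unlinked : All (λ q → ¬ Linked q (label π u) (label π w)) cs
      unlinked = proj₂ (to (free-tableOf cs (π ⟨$⟩ʳ u) (π ⟨$⟩ʳ w)) fr)
      other : ∀ {q} → (Below k q × ∃ λ j → Represents π q (B j)) × ¬ Linked q (label π u) (label π w) →
              ¬ Linked q (label π P) (label π Q)
      other ((_ , j , r) , ¬l) l with same-block f (represented-edge {i = j} r P≢Q l)
      ... | refl = ¬l (to (represents-link r) (hasEdge⇒link (B i) e))

    -- The main edge of any block of 𝓓 is covered by some chosen quad when the table is full; that
    -- quad represents a block with the same edge, which is the same block by `partition`.
    matches : Placed π k cs → Full (tableOf cs) → Matches cs 𝓓 π
    matches {π} {k} {cs} pl full = All.map (λ (_ , i , r) → lose (∈-lookup i) r) pl , All.tabulate represented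
      where
      represented : ∀ {C} → C ∈ blocks 𝓓 → Any (λ q → Represents π q C) cs
      represented {C} C∈ with Any.any? (λ q → linked? q (label π (Block.a C)) (label π (Block.b C))) cs
      ... | no ¬any = contradiction
        (from (free-tableOf cs (π ⟨$⟩ʳ Block.a C) (π ⟨$⟩ʳ Block.b C)) (ab ∘ label-injective π ∘ cong toℕ , ¬Any⇒All¬ cs ¬any))
        (full _ _)
        where
        ab : Block.a C ≢ Block.b C
        ab = hasEdge⇒≢ C (inj₁ (here refl))
      ... | yes linked with find linked
      ...   | q , q∈ , l with All.lookup pl q∈
      ...     | _ , j , r = lose q∈ (subst (Represents π q) (trans (cong B j≡i) (sym C≡)) r)
        where
        C≡ : C ≡ B (index C∈)
        C≡ = lookup-index C∈
        e : HasEdge C (Block.a C) (Block.b C)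
        e = inj₁ (here refl)
        j≡i : j ≡ index C∈
        j≡i = same-block (represented-edge {i = j} r (hasEdge⇒≢ C e) l)
                         (subst (λ D → HasEdge D (Block.a C) (Block.b C)) C≡ e)

    Sound : ℕ → Set
    Sound n = ∀ {k cs} π → k ≤ 11 → Placed π k cs → T (search n k cs (tableOf cs)) → Goal

    placed-weaken : ∀ {k k′} → k ≤ k′ → Placed π k cs → Placed π k′ cs
    placed-weaken k≤k′ = All.map λ (b , r) → below-weaken k≤k′ b , r

    module Step {n k : ℕ} {cs : List Quad} (sound : Sound n) (k≤11 : k ≤ 11)
                {i : Fin (length (blocks 𝓓))} {u w : Fin 11} (e : HasEdge (B i) u w) where

      t : Table
      t = tableOf cs

      module _ (π : Permutation′ 11) (pl : Placed π k cs) (u<k : label π u < k) (w<k : label π w < k)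
               (fr : Free π cs u w)
               (below-children : T (children n k cs t (label π u) (label π w))) where

        x y : ℕ
        x = label π u
        y = label π w

        extended : ∀ {p q a b c d} → label π p ≤ k → label π q ≤ k ⊔ suc (label π p) →
                   Represents π (quad a b c d) (B i) → Below (k ⊔ suc (label π p) ⊔ suc (label π q)) (quad a b c d) →
                   T (extend n (k ⊔ suc (label π p) ⊔ suc (label π q)) cs t (quad a b c d)) → Goal
        extended {p} {q} p≤ q≤ r b h = sound π
          (ℕ.⊔-lub (ℕ.⊔-lub k≤11 (toℕ<n (π ⟨$⟩ʳ p))) (toℕ<n (π ⟨$⟩ʳ q)))
          ((b , i , r) ∷ placed-weaken (ℕ.≤-trans (ℕ.m≤m⊔n k _) (ℕ.m≤m⊔n _ _)) pl) h

        free-edge : ∀ {P Q} → HasEdge (B i) P Q → Free π cs P Q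
        free-edge = free-block pl e fr

        completed : ∀ {P Q} → label π P ≤ k → label π Q ≤ k ⊔ suc (label π P) → HasEdge (B i) u P → HasEdge (B i) w P →
                    T (opposite n k cs t x y (label π P) (label π Q))
                  × T (adjacent n k cs t x y (label π P) (label π Q))
                  × T (adjacent n k cs t y x (label π P) (label π Q))
        completed {P} {Q} p≤ q≤ uP wP = proj₁ first , to (T-∧ {adjacent n k cs t x y p q}) (proj₂ first)
          where
          p = label π P
          q = label π Q
          inner : T (all (complete n k cs t x y p) (upTo (suc (k ⊔ suc p))))
          inner = T-⇒ {free t x p ∧ free t y p} (All.lookup (all⁺ (child n k cs t x y) (upTo (suc k)) below-children) (∈-upTo⁺ (s≤s p≤)))
                      (from (T-∧ {free t x p}) (free-edge uP , free-edge wP))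
          first = to (T-∧ {opposite n k cs t x y p q}) (All.lookup (all⁺ (complete n k cs t x y p) (upTo (suc (k ⊔ suc p))) inner) (∈-upTo⁺ (s≤s q≤)))

        module _ {P Q : Fin 11} (p≤ : label π P ≤ k) (q≤ : label π Q ≤ k ⊔ suc (label π P))
                 (u≢P : u ≢ P) (u≢Q : u ≢ Q) (w≢P : w ≢ P) (w≢Q : w ≢ Q) (P≢Q : P ≢ Q) where

          p q : ℕ
          p = label π P
          q = label π Q

          below : ∀ {x} → x < k → x < k ⊔ suc (label π P) ⊔ suc (label π Q)
          below x<k = ℕ.<-≤-trans x<k (ℕ.≤-trans (ℕ.m≤m⊔n k _) (ℕ.m≤m⊔n _ _))

          p< : label π P < k ⊔ suc (label π P) ⊔ suc (label π Q)
          p< = ℕ.≤-trans (ℕ.m≤n⊔m k _) (ℕ.m≤m⊔n _ _)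

          q< : label π Q < k ⊔ suc (label π P) ⊔ suc (label π Q)
          q< = ℕ.m≤n⊔m _ _

          opposite-form : p < q → Represents π (quad x y p q) (B i) → Goal
          opposite-form p<q r = extended {P} {Q} p≤ q≤ r ((below u<k ∷ below w<k ∷ []) , (p< ∷ q< ∷ []))
            (T-⇒ {(p <ᵇ q) ∧ free t x q ∧ free t y q}
              (proj₁ (completed {P} {Q} p≤ q≤ (represented-edge r u≢P uP) (represented-edge r w≢P wP)))
              (from (T-∧ {p <ᵇ q}) (<⇒<ᵇ p<q , from (T-∧ {free t x q})
                (free-edge (represented-edge r u≢Q uQ) , free-edge (represented-edge r w≢Q wQ)))))
            where
            uP = inj₂ (inj₁ (here refl , here refl))
            wP = inj₂ (inj₁ (there (here refl) , here refl))
            uQ = inj₂ (inj₁ (here refl , there (here refl)))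
            wQ = inj₂ (inj₁ (there (here refl) , there (here refl)))

          -- This serves both forms in which P is a main: (y, z) stands for (u, w) in `adjacent₁`
          -- and for (w, u) in `adjacent₂`.
          adjacent-form : ∀ {y z} → label π y < k → label π z < k → y ≢ P → z ≢ P → y ≢ Q → z ≢ Q →
                      Represents π (quad (label π y) p (label π z) q) (B i) →
                      (HasEdge (B i) y P → HasEdge (B i) z P → T (adjacent n k cs t (label π y) (label π z) p q)) → Goal
          adjacent-form {y} {z} y<k z<k y≢P z≢P y≢Q z≢Q r adj =
            extended {P} {Q} p≤ q≤ r ((below y<k ∷ p< ∷ []) , (below z<k ∷ q< ∷ []))
              (T-⇒ {not (q ≡ᵇ label π z) ∧ free t (label π y) q ∧ free t p q}
                (adj (represented-edge r y≢P yP) (represented-edge r z≢P zP))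
                (from (T-∧ {not (q ≡ᵇ label π z)}) (≢⇒T-not (z≢Q ∘ sym ∘ label-injective π) , from (T-∧ {free t (label π y) q})
                  (free-edge (represented-edge r y≢Q yQ) , free-edge (represented-edge r P≢Q PQ)))))
            where
            yP = inj₁ (here refl , there (here refl))
            zP = inj₂ (inj₂ (here refl , there (here refl)))
            yQ = inj₂ (inj₁ (here refl , there (here refl)))
            PQ = inj₂ (inj₁ (there (here refl) , there (here refl)))

          adjacent₁ : Represents π (quad x p y q) (B i) → Goal
          adjacent₁ r = adjacent-form u<k w<k u≢P w≢P u≢Q w≢Q r λ uP wP → proj₁ (proj₂ (completed {P} {Q} p≤ q≤ uP wP))

          adjacent₂ : Represents π (quad y p x q) (B i) → Goal
          adjacent₂ r = adjacent-form w<k u<k w≢P u≢P w≢Q u≢Q r λ wP uP → proj₂ (proj₂ (completed {P} {Q} p≤ q≤ uP wP))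

        step : (ar : Around (B i) u w) → label π (Around.P ar) ≤ k →
               label π (Around.Q ar) ≤ k ⊔ suc (label π (Around.P ar)) → Goal
        step ar p≤ q≤ with Around.role ar π
        ... | inj₂ (inj₁ r) = adjacent₁ p≤ q≤ u≢P u≢Q w≢P w≢Q P≢Q r
          where open Around ar
        ... | inj₂ (inj₂ r) = adjacent₂ p≤ q≤ u≢P u≢Q w≢P w≢Q P≢Q r
          where open Around ar
        ... | inj₁ r with ℕ.<-cmp (label π (Around.P ar)) (label π (Around.Q ar))
        ...   | tri< p<q _ _ = opposite-form p≤ q≤ u≢P u≢Q w≢P w≢Q P≢Q p<q r
          where open Around ar
        ...   | tri≈ _ p≡q _ = contradiction (label-injective π p≡q) (Around.P≢Q ar)
        -- As only p < q is tried, P and Q trade places. The bounds persist: the name of Q is below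
        -- that of P, which is at most k.
        ...   | tri> _ _ q<p = opposite-form
            (ℕ.<⇒≤ (ℕ.<-≤-trans q<p p≤)) (ℕ.≤-trans p≤ (ℕ.m≤m⊔n k _)) u≢Q u≢P w≢Q w≢P (≢-sym P≢Q) q<p (swap-minors r)
          where open Around ar

    placed-agree : ∀ {π′} → Agree k π π′ → Placed π k cs → Placed π′ k cs
    placed-agree ag = All.map λ (b , i , r) → b , i , represents-agree ag b r

    branch-sound : ∀ {n k cs} → Sound n → ∀ π → k ≤ 11 → Placed π k cs → ∀ b → T (branch n k cs (tableOf cs) b) → Goal
    branch-sound {n} {k} {cs} sound π k≤11 pl none h = [ finished , unfinished ]′ (T-if {k ≡ᵇ 11} h)
      where
      finished : T (k ≡ᵇ 11) × T (isYes (full? (tableOf cs)) ∧ accept cs) → Goal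
      finished (_ , h′) = let (full , accepted) = to (T-∧ {isYes (full? (tableOf cs))}) h′
                          in conclude (matches pl (toWitness {a? = full? (tableOf cs)} full)) accepted
      unfinished : ¬ T (k ≡ᵇ 11) × T (search n (suc k) cs (tableOf cs)) → Goal
      unfinished (k≢11 , h′) = sound π (ℕ.≤∧≢⇒< k≤11 (k≢11 ∘ ≡⇒≡ᵇ k 11)) (placed-weaken (ℕ.n≤1+n k) pl) h′
    branch-sound {n} {k} {cs} sound π k≤11 pl (best _ x y) h =
      best-sound (labelled π (ℕ.<-≤-trans x<k k≤11)) (labelled π (ℕ.<-≤-trans y<k k≤11))
      where
      t = tableOf cs
      split = to (T-∧ {(x <ᵇ k) ∧ (y <ᵇ k) ∧ free t x y}) h
      guard = to (T-∧ {x <ᵇ k}) (proj₁ split)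
      guard′ = to (T-∧ {y <ᵇ k}) (proj₂ guard)
      x<k : x < k
      x<k = <ᵇ⇒< x k (proj₁ guard)
      y<k : y < k
      y<k = <ᵇ⇒< y k (proj₁ guard′)
      fr : T (free t x y)
      fr = proj₂ guard′

      best-sound : (∃ λ u → label π u ≡ x) → (∃ λ w → label π w ≡ y) → Goal
      -- P is settled first, then Q above the name of P, so that the second renaming disturbs none
      -- of u, w, P.
      best-sound (u , u≡x) (w , w≡y) = relabelled (settle π k P)
        where
        u≢w : u ≢ w
        u≢w u≡w = proj₁ (to (free-tableOf cs (π ⟨$⟩ʳ u) (π ⟨$⟩ʳ w))
                            (subst₂ (λ a b → T (free t a b)) (sym u≡x) (sym w≡y) fr))
                        (cong (π ⟨$⟩ʳ_) u≡w)
        i = proj₁ (partition 𝓓 u w u≢w)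
        e : HasEdge (B i) u w
        e = proj₁ (proj₂ (partition 𝓓 u w u≢w))
        ar = around (B i) e
        open Around ar using (P; Q)

        -- Taking x and y as variables lets them be unified with the names of u and w.
        finish : ∀ π′ {x y} → label π′ u ≡ x → label π′ w ≡ y → Placed π′ k cs → x < k → y < k → T (free t x y) →
                 T (children n k cs t x y) →
                 label π′ P ≤ k → label π′ Q ≤ k ⊔ suc (label π′ P) → Goal
        finish π′ refl refl pl′ x< y< f c = Step.step {n} {k} {cs} sound k≤11 e π′ pl′ x< y< f c ar

        relabelled : Σ[ π₁ ∈ Permutation′ 11 ] label π₁ P ≤ k × Agree k π π₁ → Goal
        relabelled (π₁ , p≤ , ag₁) = relabelled₂ (settle π₁ (k ⊔ suc (label π₁ P)) Q)
          where
          relabelled₂ : Σ[ π₂ ∈ Permutation′ 11 ] label π₂ Q ≤ k ⊔ suc (label π₁ P) ×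
                         Agree (k ⊔ suc (label π₁ P)) π₁ π₂ → Goal
          relabelled₂ (π₂ , q≤ , ag₂) =
            finish π₂ (keep u≡x x<k) (keep w≡y y<k) (placed-agree {π = π₁} ag₂′ (placed-agree {π = π} ag₁ pl))
              x<k y<k fr (proj₂ split)
              (subst (_≤ k) (sym p≡) p≤) (subst (λ p → label π₂ Q ≤ k ⊔ suc p) (sym p≡) q≤)
            where
            ag₂′ : Agree k π₁ π₂
            ag₂′ = agree-weaken {π = π₁} {π₂} (ℕ.m≤m⊔n k _) ag₂
            keep : ∀ {z l} → label π z ≡ l → l < k → label π₂ z ≡ l
            keep {z} refl l<k = trans (agree-below {π = π₁} {π₂} ag₂′ (subst (_< k) (sym eq) l<k)) eq
              where eq = agree-below {π = π} {π₁} ag₁ l<k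
            p≡ : label π₂ P ≡ label π₁ P
            p≡ = agree-below {π = π₁} {π₂} ag₂ (ℕ.m≤n⊔m k _)

    -- Running out of depth yields `false`, so zero needs no clause.
    search-sound : ∀ n → Sound n
    search-sound (suc n) {k} {cs} π k≤11 pl h = branch-sound (search-sound n) π k≤11 pl (pick k (tableOf cs)) h

-- The first block and the classification

-- Once z has the name k, the other vertices of the list have names of at least k + 1, and the later
-- renamings leave k alone.
assign : (π : Permutation′ v) (k : ℕ) (zs : List (Fin v)) → Unique zs → All (λ z → k ≤ label π z) zs →
         Σ[ π′ ∈ Permutation′ v ] map (label π′) zs ≡ iterate suc k (length zs) × Agree k π π′
assign π k []       _           _           = π , refl , λ _ → inj₁ refl
assign π k (z ∷ zs) (z∉zs ∷ u) (k≤z ∷ k≤zs) with relabel π k z k≤z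
... | π₁ , z≡k , ag₁ with assign π₁ (suc k) zs u (All.zipWith above (z∉zs , k≤zs))
  where
  above : ∀ {z′} → z ≢ z′ × k ≤ label π z′ → suc k ≤ label π₁ z′
  above {z′} (z≢z′ , k≤z′) = ℕ.≤∧≢⇒< ([ (λ eq → subst (k ≤_) (sym eq) k≤z′) , proj₂ ]′ (ag₁ z′))
                                     (λ k≡ → z≢z′ (label-injective π₁ (trans z≡k k≡)))
... | π₂ , zs≡ , ag₂ = π₂ , cong₂ _∷_ (trans (agree-below {π = π₁} {π₂} ag₂ (ℕ.≤-reflexive (cong suc z≡k))) z≡k) zs≡ , agree
  where
  agree : Agree k π π₂
  agree w with ag₁ w | agree-weaken {π = π₁} {π₂} (ℕ.n≤1+n k) ag₂ w
  ... | inj₁ p       | inj₁ q       = inj₁ (trans q p)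
  ... | inj₁ p       | inj₂ (q , r) = inj₂ (subst (k ≤_) p q , r)
  ... | inj₂ (p , q) | inj₁ r       = inj₂ (p , subst (k ≤_) (sym r) q)
  ... | inj₂ (p , _) | inj₂ (_ , r) = inj₂ (p , r)

quad-cong : ∀ {a b c d a′ b′ c′ d′} → (List ℕ ∋ a ∷ b ∷ c ∷ d ∷ []) ≡ a′ ∷ b′ ∷ c′ ∷ d′ ∷ [] →
            quad a b c d ≡ quad a′ b′ c′ d′
quad-cong refl = refl

start : Quad
start = quad 0 1 2 3

represents-start : (B : Block v) → Σ[ π ∈ Permutation′ v ] Represents π start B
represents-start B with assign id 0 _ (Block.distinct B) (z≤n ∷ z≤n ∷ z≤n ∷ z≤n ∷ [])
... | π , eq , _ = π , subst (λ q → Represents π q B) (quad-cong eq) (represents-self π B)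

Recognised : List Quad → Set
Recognised cs = Any (Matches cs 𝓓₁) relabellings₁ ⊎ Any (Matches cs 𝓓₂) relabellings₂

recognised? : ∀ cs → Dec (Recognised cs)
recognised? cs = Any.any? (matches? cs 𝓓₁) relabellings₁ ⊎-dec Any.any? (matches? cs 𝓓₂) relabellings₂

recognise : List Quad → Bool
recognise cs = isYes (recognised? cs)

-- The type checker runs the whole case distinction. Depth 20 suffices: a path adds at most 10
-- blocks, since 11 blocks use up all 55 edges, takes at most 7 steps that only add a name, and ends
-- in a leaf.
certificate : Search.search recognise 20 4 (start ∷ []) (tableOf (start ∷ [])) ≡ true
certificate = refl

module _ (accept : List Quad → Bool) {n : ℕ}
         (cert : Search.search accept n 4 (start ∷ []) (tableOf (start ∷ [])) ≡ true)
         (𝓓 : Design 11) {Goal : Set} (conclude : ∀ {cs π} → Matches cs 𝓓 π → T (accept cs) → Goal) where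

  classify : Goal
  classify = search-sound n π (ℕ.m≤m+n 4 7) ((below , i , r) ∷ []) (from T-≡ cert)
    where
    open Search accept
    open Soundness 𝓓 Goal conclude
    -- Some block must serve as the root; covering the edge between vertices 0 and 1 supplies one.
    i = proj₁ (partition 𝓓 zero (suc zero) λ ())
    π = proj₁ (represents-start (lookup (blocks 𝓓) i))
    r = proj₂ (represents-start (lookup (blocks 𝓓) i))
    below : Below 4 start
    below = (ℕ.m≤m+n 1 3 ∷ ℕ.m≤m+n 2 2 ∷ []) , (ℕ.m≤m+n 3 1 ∷ ℕ.m≤m+n 4 0 ∷ [])

-- The leaf that matches 𝓓 is recognised, so it also matches `𝓓₁` or `𝓓₂` under one of the listed
-- namings.
classification : (𝓓 : Design 11) → (𝓓 ≅ 𝓓₁) ⊎ (𝓓 ≅ 𝓓₂)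
classification 𝓓 = classify recognise {20} certificate 𝓓 conclude
  where
  conclude : ∀ {cs π} → Matches cs 𝓓 π → T (recognise cs) → (𝓓 ≅ 𝓓₁) ⊎ (𝓓 ≅ 𝓓₂)
  conclude {cs} {π} m accepted = Sum.map (match 𝓓₁) (match 𝓓₂) (toWitness {a? = recognised? cs} accepted)
    where
    match : ∀ 𝓔 {ρs} → Any (Matches cs 𝓔) ρs → 𝓓 ≅ 𝓔
    match 𝓔 found = let (τ , _ , m′) = find found in matches⇒≅ {cs = cs} {𝓓} {𝓔} {π} {τ} m m′

theorem3p3 : Σ[ 𝓓₁ ∈ Design 11 ] Σ[ 𝓓₂ ∈ Design 11 ]
    (¬ (𝓓₁ ≅ 𝓓₂) × ((𝓓 : Design 11) → (𝓓 ≅ 𝓓₁) ⊎ (𝓓 ≅ 𝓓₂)))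
theorem3p3 = 𝓓₁ , 𝓓₂ , 𝓓₁≇𝓓₂ , classification
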